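{- Every polynomial in $\mathcal{LP}_4$ is of the form $f[h,h']$, where $$f:=(a^3xy+a(x+y)+a^2)xy+x+y\in\mathcal{RLP}_4,\qquad h:=bx^2+cx+d\in\mathcal{P}_4,\qquad h':=b'x^2+c'x+d'\in\mathcal{P}_4,$$ with $a,b,c,d,b',c',d'\in\mathbb{F}_4$ such that $b^3+c^3=1=b'^3+c'^3$.
   Context: $\mathbb{F}_4$ is the field with four elements. $\mathcal{P}_4$ is the set of polynomials in $\mathbb{F}_4[x]$ of degree less than $4$ that act as permutations of $\mathbb{F}_4$. $\mathcal{LP}_4$ is the set of polynomials $f\in\mathbb{F}_4[x,y]$ of degree less than $4$ in each variable such that, for every $a\in\mathbb{F}_4$, both $f(x,a)$ and $f(a,x)$ act as permutations of $\mathbb{F}_4$. $\mathcal{RLP}_4$ is the set of reduced polynomials in $\mathcal{LP}_4$, i.e. those $f$ with $f(x,0)=x$ and $f(0,y)=y$. For $f\in\mathcal{LP}_4$ and $g,h\in\mathcal{P}_4$, $f[g,h]:=f(g(x),h(y))$, the composition being taken modulo $x^4-x$ and $y^4-y$. -}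

module Defs where

open import Algebra.Apartness.Bundles using (HeytingCommutativeRing; HeytingField)
open import Algebra.Bundles using (CommutativeRing; Semiring)
open import Algebra.Bundles.Raw using (RawSemiring)
open import Algebra.Definitions using (Invertible)
import Algebra.Definitions.RawSemiring as RawSemiringDefinitions
open import Algebra.Structures using (IsCommutativeRing)
open import Data.List.Base as List using (List; []; _∷_; [_])
open import Data.Nat.Base using (ℕ; zero; suc)
open import Data.Product.Base using (_×_; _,_)
open import Data.Sum.Base using (_⊎_; inj₁; inj₂)
open import Data.Vec.Base as Vec using (Vec; []; _∷_)
open import Function.Base using (id; _∘_)
open import Function.Definitions using (Bijective)
open import Level using (Level; 0ℓ)
open import Relation.Binary.Definitions using (DecidableEquality)
open import Relation.Binary.PropositionalEquality
  using (_≡_; _≢_; refl; cong₂; isEquivalence; ≢-sym)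
open import Relation.Nullary.Decidable
  using (Dec; yes; no; map′; _×-dec_; _→-dec_; from-yes; decidable-stable)

private
  variable
    c ℓ c′ ℓ′ : Level

-- A list holds the coefficients of a univariate polynomial, constant term
-- first; trailing zeros are allowed and ignored by the equality of R [X].

module Coefficients (R : RawSemiring c ℓ) where
  open RawSemiring R

  coeff : List Carrier → ℕ → Carrier
  coeff []      _       = 0#
  coeff (a ∷ _) zero    = a
  coeff (_ ∷ p) (suc n) = coeff p n

  add : List Carrier → List Carrier → List Carrier
  add []      q       = q
  add (a ∷ p) []      = a ∷ p
  add (a ∷ p) (b ∷ q) = (a + b) ∷ add p q

  mul : List Carrier → List Carrier → List Carrier
  mul []      _ = []
  mul (a ∷ p) q = add (List.map (a *_) q) (0# ∷ mul p q)

  -- The remainder modulo X⁴ - X: if c₀ + c₁X + c₂X² + c₃X³ is the remainder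
  -- of p, then X⁴ = X turns a + X·p into a + (c₀ + c₃)X + c₁X² + c₂X³.
  -- A polynomial of degree less than 4 is its own remainder.
  reduce : List Carrier → Vec Carrier 4
  reduce []      = Vec.replicate 4 0#
  reduce (a ∷ p) with reduce p
  ... | c₀ ∷ c₁ ∷ c₂ ∷ c₃ ∷ [] = a ∷ (c₀ + c₃) ∷ c₁ ∷ c₂ ∷ []

infix 9 _[X]

_[X] : RawSemiring c ℓ → RawSemiring c ℓ
R [X] = record
  { Carrier = List (RawSemiring.Carrier R)
  ; _≈_     = λ p q → ∀ n → RawSemiring._≈_ R (coeff p n) (coeff q n)
  ; _+_     = add
  ; _*_     = mul
  ; 0#      = []
  ; 1#      = [ RawSemiring.1# R ]
  }
  where open Coefficients R

-- The value at s ∈ S of a polynomial whose coefficients are carried into S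
-- by φ.
substitute : {A : Set c} (S : RawSemiring c′ ℓ′) →
             (φ : A → RawSemiring.Carrier S) (s : RawSemiring.Carrier S) →
             List A → RawSemiring.Carrier S
substitute S φ s = List.foldr (λ a r → φ a + s * r) 0#
  where open RawSemiring S

-- 𝔽₂[ω] with ω² = ω + 1

data 𝔽₄ : Set where
  𝟎 𝟏 ω ω² : 𝔽₄

infixl 6 _+_
infixl 7 _*_

_+_ : 𝔽₄ → 𝔽₄ → 𝔽₄
𝟎  + y  = y
x  + 𝟎  = x
𝟏  + 𝟏  = 𝟎
𝟏  + ω  = ω²
𝟏  + ω² = ω
ω  + 𝟏  = ω²
ω  + ω  = 𝟎
ω  + ω² = 𝟏
ω² + 𝟏  = ω
ω² + ω  = 𝟏
ω² + ω² = 𝟎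

_*_ : 𝔽₄ → 𝔽₄ → 𝔽₄
𝟎  * y  = 𝟎
x  * 𝟎  = 𝟎
𝟏  * y  = y
x  * 𝟏  = x
ω  * ω  = ω²
ω  * ω² = 𝟏
ω² * ω  = 𝟏
ω² * ω² = ω

infix 4 _≟_

_≟_ : DecidableEquality 𝔽₄
𝟎  ≟ 𝟎  = yes refl
𝟎  ≟ 𝟏  = no λ ()
𝟎  ≟ ω  = no λ ()
𝟎  ≟ ω² = no λ ()
𝟏  ≟ 𝟎  = no λ ()
𝟏  ≟ 𝟏  = yes refl
𝟏  ≟ ω  = no λ ()
𝟏  ≟ ω² = no λ ()
ω  ≟ 𝟎  = no λ ()
ω  ≟ 𝟏  = no λ ()
ω  ≟ ω  = yes refl
ω  ≟ ω² = no λ ()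
ω² ≟ 𝟎  = no λ ()
ω² ≟ 𝟏  = no λ ()
ω² ≟ ω  = no λ ()
ω² ≟ ω² = yes refl

∀? : {P : 𝔽₄ → Set} → (∀ x → Dec (P x)) → Dec (∀ x → P x)
∀? P? = map′
  (λ { (p , q , r , s) → λ { 𝟎 → p ; 𝟏 → q ; ω → r ; ω² → s } })
  (λ p → p 𝟎 , p 𝟏 , p ω , p ω²)
  (P? 𝟎 ×-dec P? 𝟏 ×-dec P? ω ×-dec P? ω²)

+-*-isCommutativeRing : IsCommutativeRing _≡_ _+_ _*_ id 𝟎 𝟏
+-*-isCommutativeRing = record
  { isRing = record
    { +-isAbelianGroup = record
      { isGroup = record
        { isMonoid = record
          { isSemigroup = record
            { isMagma = record { isEquivalence = isEquivalence ; ∙-cong = cong₂ _+_ }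
            ; assoc   = from-yes (∀? λ x → ∀? λ y → ∀? λ z → (x + y) + z ≟ x + (y + z))
            }
          ; identity = (λ _ → refl) , from-yes (∀? λ x → x + 𝟎 ≟ x)
          }
        ; inverse = from-yes (∀? λ x → x + x ≟ 𝟎) , from-yes (∀? λ x → x + x ≟ 𝟎)
        ; ⁻¹-cong = λ { refl → refl }
        }
      ; comm = from-yes (∀? λ x → ∀? λ y → x + y ≟ y + x)
      }
    ; *-cong     = cong₂ _*_
    ; *-assoc    = from-yes (∀? λ x → ∀? λ y → ∀? λ z → (x * y) * z ≟ x * (y * z))
    ; *-identity = from-yes (∀? λ x → 𝟏 * x ≟ x) , from-yes (∀? λ x → x * 𝟏 ≟ x)
    ; distrib    = from-yes (∀? λ x → ∀? λ y → ∀? λ z → x * (y + z) ≟ x * y + x * z)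
                 , from-yes (∀? λ x → ∀? λ y → ∀? λ z → (y + z) * x ≟ y * x + z * x)
    }
  ; *-comm = from-yes (∀? λ x → ∀? λ y → x * y ≟ y * x)
  }

≢𝟎⇒invertible : ∀ x → x ≢ 𝟎 → Invertible _≡_ 𝟏 _*_ x
≢𝟎⇒invertible 𝟎  x≢𝟎 with () ← x≢𝟎 refl
≢𝟎⇒invertible 𝟏  _ = 𝟏 , refl , refl
≢𝟎⇒invertible ω  _ = ω² , refl , refl
≢𝟎⇒invertible ω² _ = ω , refl , refl

invertible⇒≢𝟎 : ∀ {x} → Invertible _≡_ 𝟏 _*_ x → x ≢ 𝟎
invertible⇒≢𝟎 {x} (y , _ , x*y≡𝟏) refl with () ← x*y≡𝟏

+-≡𝟎⇒≡ : ∀ x y → x + y ≡ 𝟎 → x ≡ y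
+-≡𝟎⇒≡ = from-yes (∀? λ x → ∀? λ y → (x + y ≟ 𝟎) →-dec (x ≟ y))

𝔽₄-heytingField : HeytingField 0ℓ 0ℓ 0ℓ
𝔽₄-heytingField = record
  { _#_ = _≢_
  ; isHeytingField = record
    { isHeytingCommutativeRing = record
      { isCommutativeRing   = +-*-isCommutativeRing
      ; isApartnessRelation = record
        { irrefl  = λ { refl x≢x → x≢x refl }
        ; sym     = ≢-sym
        ; cotrans = cotrans
        }
      ; #⇒invertible = λ {x} {y} x≢y → ≢𝟎⇒invertible (x + y) (x≢y ∘ +-≡𝟎⇒≡ x y)
      ; invertible⇒# = λ { {x} inv refl → invertible⇒≢𝟎 inv (x+x≡𝟎 x) }
      }
    ; tight = λ x y → decidable-stable (x ≟ y) , λ { refl x≢x → x≢x refl }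
    }
  }
  where
  x+x≡𝟎 : ∀ x → x + x ≡ 𝟎
  x+x≡𝟎 = from-yes (∀? λ x → x + x ≟ 𝟎)

  cotrans : ∀ {x y} → x ≢ y → ∀ z → (x ≢ z) ⊎ (z ≢ y)
  cotrans {x} x≢y z with x ≟ z
  ... | yes refl = inj₂ x≢y
  ... | no x≢z   = inj₁ x≢z

𝔽₄-rawSemiring : RawSemiring 0ℓ 0ℓ
𝔽₄-rawSemiring = Semiring.rawSemiring
  (CommutativeRing.semiring
    (HeytingCommutativeRing.commutativeRing
      (HeytingField.heytingCommutativeRing 𝔽₄-heytingField)))

open RawSemiringDefinitions 𝔽₄-rawSemiring public using (_^_)

-- 𝔽₄[x], and 𝔽₄[x,y] as (𝔽₄[x])[y]

𝔽₄[x] 𝔽₄[x,y] : RawSemiring 0ℓ 0ℓ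
𝔽₄[x]   = 𝔽₄-rawSemiring [X]
𝔽₄[x,y] = 𝔽₄[x] [X]

-- Polynomials of degree less than 4 (in each variable), on which _≡_ is
-- equality of polynomials. In Poly₂, the j-th entry is the coefficient of yʲ,
-- a polynomial in x.

Poly Poly₂ : Set
Poly  = Vec 𝔽₄ 4
Poly₂ = Vec Poly 4

toList₂ : Poly₂ → List (List 𝔽₄)
toList₂ f = Vec.toList (Vec.map Vec.toList f)

reduce : List 𝔽₄ → Poly
reduce = Coefficients.reduce 𝔽₄-rawSemiring

-- The remainder modulo y⁴ - y, and then modulo x⁴ - x.
reduce₂ : List (List 𝔽₄) → Poly₂
reduce₂ f = Vec.map reduce (Coefficients.reduce 𝔽₄[x] f)

eval : Poly → 𝔽₄ → 𝔽₄
eval p a = substitute 𝔽₄-rawSemiring id a (Vec.toList p)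

-- f(x,a) and f(a,y), each as a polynomial in the remaining variable
_⟨x,_⟩ _⟨_,y⟩ : Poly₂ → 𝔽₄ → Poly
f ⟨x, a ⟩ = Vec.map (λ p → eval p a) (Vec.transpose f)
f ⟨ a ,y⟩ = Vec.map (λ p → eval p a) f

𝒫₄ : Poly → Set
𝒫₄ p = Bijective _≡_ _≡_ (eval p)

ℒ𝒫₄ : Poly₂ → Set
ℒ𝒫₄ f = ∀ a → 𝒫₄ (f ⟨x, a ⟩) × 𝒫₄ (f ⟨ a ,y⟩)

identity : Poly
identity = 𝟎 ∷ 𝟏 ∷ 𝟎 ∷ 𝟎 ∷ []

ℛℒ𝒫₄ : Poly₂ → Set
ℛℒ𝒫₄ f = ℒ𝒫₄ f × f ⟨x, 𝟎 ⟩ ≡ identity × f ⟨ 𝟎 ,y⟩ ≡ identity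

-- f(g(x),h(y)) is formed in 𝔽₄[x,y] and then reduced. The coefficients of f
-- as a polynomial in y become constants in y after x is replaced by g(x),
-- while the coefficients of h become constants in x.
_[_,_] : Poly₂ → Poly → Poly → Poly₂
f [ g , h ] = reduce₂ (substitute 𝔽₄[x,y] (λ p → [ p∘g p ]) h[y] (toList₂ f))
  where
  p∘g : List 𝔽₄ → List 𝔽₄
  p∘g = substitute 𝔽₄[x] [_] (Vec.toList g)

  h[y] : List (List 𝔽₄)
  h[y] = List.map [_] (Vec.toList h)

reducedPoly : 𝔽₄ → Poly₂
reducedPoly a = reduce₂
  ((const (a ^ 3) · x · y ⊞ const a · (x ⊞ y) ⊞ const (a ^ 2)) · x · y ⊞ x ⊞ y)
  where
  open RawSemiring 𝔽₄[x,y] renaming (_+_ to infixl 6 _⊞_; _*_ to infixl 7 _·_)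

  const : 𝔽₄ → Carrier
  const e = [ [ e ] ]

  x y : Carrier
  x = [ 𝟎 ∷ 𝟏 ∷ [] ]
  y = [] ∷ [ 𝟏 ] ∷ []

-- bx² + cx + d
quadratic : 𝔽₄ → 𝔽₄ → 𝔽₄ → Poly
quadratic b c d = d ∷ c ∷ b ∷ 𝟎 ∷ []

{-# OPTIONS --safe #-}

-- Polynomials over 𝔽₄ of degree less than 4 in each variable correspond to
-- functions, so p is a Latin square of order 4. Let h′ = p(0,y), and h = p(x,y₀)
-- with p(0,y₀) = 0: permuting rows by h⁻¹ and columns by h′⁻¹ turns p into a
-- square whose first row and column are the identity. There are exactly four
-- of these, and they are the functions of reducedPoly a. Finally, a polynomial
-- that permutes 𝔽₄ has the form bx² + cx + d with b³ + c³ = 1.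
module Submission where

open import Defs
open import Algebra.Bundles using (CommutativeSemiring; CommutativeRing; RawSemiring)
open import Algebra.Morphism.Definitions using (Homomorphic₀; Homomorphic₂)
import Algebra.Solver.Ring.NaturalCoefficients.Default as SemiringSolver
open import Algebra.Apartness.Bundles using (HeytingCommutativeRing; HeytingField)
open import Data.List.Base as List using (List; []; _∷_)
open import Data.Nat.Base using (zero; suc)
open import Data.Product.Base using (_×_; ∃-syntax; _,_; proj₁; proj₂)
open import Data.Sum.Base using (inj₁; inj₂)
open import Data.Vec.Base as Vec using (Vec; []; _∷_)
open import Data.Vec.Properties using (∷-injective; ≡-dec; toList-map)
open import Function.Base using (id; _∘_)
open import Level using (Level)
open import Relation.Binary.PropositionalEquality
  using (_≡_; refl; sym; trans; cong; cong₂; subst; module ≡-Reasoning)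
open import Relation.Nullary.Decidable
  using (Dec; map′; _×-dec_; _⊎-dec_; _→-dec_; from-yes)

private
  variable
    c ℓ c′ ℓ′ : Level

-- Evaluation of coefficient lists

-- `R` is only a raw semiring so that the module can be used once per variable: with coefficients in
-- `𝔽₄` and `φ = id`, then with coefficients in `𝔽₄[x]` and `φ` the evaluation at x = a.
module Substitution
  (R : RawSemiring c ℓ) (S : CommutativeSemiring c′ ℓ′)
  (φ : RawSemiring.Carrier R → CommutativeSemiring.Carrier S)
  (φ-0 : Homomorphic₀ _ _ (CommutativeSemiring._≈_ S) φ (RawSemiring.0# R) (CommutativeSemiring.0# S))
  (φ-+ : Homomorphic₂ _ _ (CommutativeSemiring._≈_ S) φ (RawSemiring._+_ R) (CommutativeSemiring._+_ S))
  where

  open CommutativeSemiring S using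
    ( Carrier; _≈_; 0#; rawSemiring; setoid; +-cong; +-congˡ; *-congˡ; *-congʳ
    ; +-identityˡ; +-identityʳ; zeroˡ; zeroʳ)
    renaming
    ( _+_ to infixl 6 _⊕_; _*_ to infixl 7 _⊗_
    ; refl to ≈-refl; sym to ≈-sym; trans to ≈-trans)
  open Coefficients R renaming (reduce to remainder)
  open import Relation.Binary.Reasoning.Setoid setoid
  open SemiringSolver S using (solve; _:+_; _:*_; _:=_; con)
  private
    module R = RawSemiring R

  module _ (s : Carrier) where
    ⟦_⟧ : List R.Carrier → Carrier
    ⟦_⟧ = substitute rawSemiring φ s

    substitute-add : ∀ p q → ⟦ add p q ⟧ ≈ ⟦ p ⟧ ⊕ ⟦ q ⟧
    substitute-add []      q  = ≈-sym (+-identityˡ ⟦ q ⟧)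
    substitute-add (a ∷ p) [] = ≈-sym (+-identityʳ ⟦ a ∷ p ⟧)
    substitute-add (a ∷ p) (b ∷ q) = begin
      φ (a R.+ b) ⊕ s ⊗ ⟦ add p q ⟧          ≈⟨ +-cong (φ-+ a b) (*-congˡ (substitute-add p q)) ⟩
      (φ a ⊕ φ b) ⊕ s ⊗ (⟦ p ⟧ ⊕ ⟦ q ⟧)      ≈⟨ solve 5 (λ a b s p q → (a :+ b) :+ s :* (p :+ q) := (a :+ s :* p) :+ (b :+ s :* q))
                                                   ≈-refl (φ a) (φ b) s ⟦ p ⟧ ⟦ q ⟧ ⟩
      (φ a ⊕ s ⊗ ⟦ p ⟧) ⊕ (φ b ⊕ s ⊗ ⟦ q ⟧)  ∎

    -- `remainder` follows Horner's scheme except that it moves the coefficient c₃ from X⁴ to X,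
    -- which does not change the value at a point with s⁴ = s.
    substitute-reduce : s ⊗ (s ⊗ (s ⊗ s)) ≈ s → ∀ p → ⟦ Vec.toList (remainder p) ⟧ ≈ ⟦ p ⟧
    substitute-reduce s⁴≈s [] = begin
      ⟦ R.0# ∷ R.0# ∷ R.0# ∷ R.0# ∷ [] ⟧  ≈⟨ φ0+s* (φ0+s* (φ0+s* (φ0+s* ≈-refl))) ⟩
      0#                                  ∎
      where
      φ0+s* : ∀ {x} → x ≈ 0# → φ R.0# ⊕ s ⊗ x ≈ 0#
      φ0+s* {x} x≈0 = begin
        φ R.0# ⊕ s ⊗ x  ≈⟨ +-cong φ-0 (*-congˡ x≈0) ⟩
        0# ⊕ s ⊗ 0#     ≈⟨ ≈-trans (+-identityˡ _) (zeroʳ s) ⟩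
        0#              ∎
    substitute-reduce s⁴≈s (a ∷ p) with remainder p | substitute-reduce s⁴≈s p
    ... | c₀ ∷ c₁ ∷ c₂ ∷ c₃ ∷ [] | ih = +-congˡ (begin
      s ⊗ (φ (c₀ R.+ c₃) ⊕ s ⊗ (φ c₁ ⊕ s ⊗ (φ c₂ ⊕ s ⊗ 0#)))
        ≈⟨ *-congˡ (+-cong (φ-+ c₀ c₃) ≈-refl) ⟩
      s ⊗ ((φ c₀ ⊕ φ c₃) ⊕ s ⊗ (φ c₁ ⊕ s ⊗ (φ c₂ ⊕ s ⊗ 0#)))
        ≈⟨ solve 5 (λ s c₀ c₁ c₂ c₃ →
             s :* ((c₀ :+ c₃) :+ s :* (c₁ :+ s :* (c₂ :+ s :* con 0)))
             := s :* c₀ :+ s :* (s :* (c₁ :+ s :* c₂)) :+ s :* c₃)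
             ≈-refl s (φ c₀) (φ c₁) (φ c₂) (φ c₃) ⟩
      s ⊗ φ c₀ ⊕ s ⊗ (s ⊗ (φ c₁ ⊕ s ⊗ φ c₂)) ⊕ s ⊗ φ c₃
        -- Read backwards, s⁴ = s lifts the wrapped term s c₃ back to s⁴ c₃.
        ≈⟨ +-congˡ (*-congʳ s⁴≈s) ⟨
      s ⊗ φ c₀ ⊕ s ⊗ (s ⊗ (φ c₁ ⊕ s ⊗ φ c₂)) ⊕ s ⊗ (s ⊗ (s ⊗ s)) ⊗ φ c₃
        ≈⟨ solve 5 (λ s c₀ c₁ c₂ c₃ →
             s :* c₀ :+ s :* (s :* (c₁ :+ s :* c₂)) :+ s :* (s :* (s :* s)) :* c₃
             := s :* (c₀ :+ s :* (c₁ :+ s :* (c₂ :+ s :* (c₃ :+ s :* con 0)))))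
             ≈-refl s (φ c₀) (φ c₁) (φ c₂) (φ c₃) ⟩
      s ⊗ ⟦ c₀ ∷ c₁ ∷ c₂ ∷ c₃ ∷ [] ⟧
        ≈⟨ *-congˡ ih ⟩
      s ⊗ ⟦ p ⟧ ∎)

    module _ (φ-* : ∀ a b → φ (a R.* b) ≈ φ a ⊗ φ b) where

      substitute-scale : ∀ a p → ⟦ List.map (a R.*_) p ⟧ ≈ φ a ⊗ ⟦ p ⟧
      substitute-scale a []      = ≈-sym (zeroʳ (φ a))
      substitute-scale a (b ∷ p) = begin
        φ (a R.* b) ⊕ s ⊗ ⟦ List.map (a R.*_) p ⟧  ≈⟨ +-cong (φ-* a b) (*-congˡ (substitute-scale a p)) ⟩
        φ a ⊗ φ b ⊕ s ⊗ (φ a ⊗ ⟦ p ⟧)              ≈⟨ solve 4 (λ a b s p → a :* b :+ s :* (a :* p) := a :* (b :+ s :* p))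
                                                       ≈-refl (φ a) (φ b) s ⟦ p ⟧ ⟩
        φ a ⊗ (φ b ⊕ s ⊗ ⟦ p ⟧)                    ∎

      substitute-mul : ∀ p q → ⟦ mul p q ⟧ ≈ ⟦ p ⟧ ⊗ ⟦ q ⟧
      substitute-mul []      q = ≈-sym (zeroˡ ⟦ q ⟧)
      substitute-mul (a ∷ p) q = begin
        ⟦ add (List.map (a R.*_) q) (R.0# ∷ mul p q) ⟧       ≈⟨ substitute-add (List.map (a R.*_) q) _ ⟩
        ⟦ List.map (a R.*_) q ⟧ ⊕ (φ R.0# ⊕ s ⊗ ⟦ mul p q ⟧) ≈⟨ +-cong (substitute-scale a q) (+-cong φ-0 (*-congˡ (substitute-mul p q))) ⟩
        φ a ⊗ ⟦ q ⟧ ⊕ (0# ⊕ s ⊗ (⟦ p ⟧ ⊗ ⟦ q ⟧))             ≈⟨ solve 4 (λ a s p q → a :* q :+ (con 0 :+ s :* (p :* q)) := (a :+ s :* p) :* q)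
                                                                 ≈-refl (φ a) s ⟦ p ⟧ ⟦ q ⟧ ⟩
        (φ a ⊕ s ⊗ ⟦ p ⟧) ⊗ ⟦ q ⟧                            ∎

-- Evaluation over 𝔽₄ in one and two variables

𝔽₄-commutativeSemiring : CommutativeSemiring _ _
𝔽₄-commutativeSemiring = CommutativeRing.commutativeSemiring
  (HeytingCommutativeRing.commutativeRing
    (HeytingField.heytingCommutativeRing 𝔽₄-heytingField))

open CommutativeSemiring 𝔽₄-commutativeSemiring using (+-identityʳ; zeroʳ)

substitute-map : ∀ {A B : Set} (φ : B → 𝔽₄) (ψ : A → B) s (p : List A) →
  substitute 𝔽₄-rawSemiring φ s (List.map ψ p) ≡ substitute 𝔽₄-rawSemiring (φ ∘ ψ) s p
substitute-map φ ψ s []      = refl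
substitute-map φ ψ s (a ∷ p) = cong (λ r → φ (ψ a) + s * r) (substitute-map φ ψ s p)

substitute-cong : ∀ {A : Set} {φ ψ : A → 𝔽₄} → (∀ a → φ a ≡ ψ a) → ∀ s p →
  substitute 𝔽₄-rawSemiring φ s p ≡ substitute 𝔽₄-rawSemiring ψ s p
substitute-cong φ≗ψ s []      = refl
substitute-cong φ≗ψ s (a ∷ p) = cong₂ (λ u r → u + s * r) (φ≗ψ a) (substitute-cong φ≗ψ s p)

module _ {A : Set} (R : RawSemiring c ℓ)
  (χ : RawSemiring.Carrier R → 𝔽₄)
  (χ-0 : χ (RawSemiring.0# R) ≡ 𝟎)
  (χ-+ : ∀ a b → χ (RawSemiring._+_ R a b) ≡ χ a + χ b)
  (χ-* : ∀ a b → χ (RawSemiring._*_ R a b) ≡ χ a * χ b) where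

  -- Horner's scheme is built from zero, sums and products, so `χ` passes through it. With `χ` an
  -- evaluation, this turns substitution of polynomials into composition of functions.
  substitute-homo : ∀ (φ : A → RawSemiring.Carrier R) s p →
    χ (substitute R φ s p) ≡ substitute 𝔽₄-rawSemiring (χ ∘ φ) (χ s) p
  substitute-homo φ s []      = χ-0
  substitute-homo φ s (a ∷ p) = trans (χ-+ _ _)
    (cong (χ (φ a) +_) (trans (χ-* _ _) (cong (χ s *_) (substitute-homo φ s p))))

evalList : 𝔽₄ → List 𝔽₄ → 𝔽₄
evalList = substitute 𝔽₄-rawSemiring id

evalList₂ : 𝔽₄ → 𝔽₄ → List (List 𝔽₄) → 𝔽₄
evalList₂ a = substitute 𝔽₄-rawSemiring (evalList a)

eval₂ : Poly₂ → 𝔽₄ → 𝔽₄ → 𝔽₄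
eval₂ f a b = eval (f ⟨ a ,y⟩) b

module Eval = Substitution 𝔽₄-rawSemiring 𝔽₄-commutativeSemiring id refl (λ _ _ → refl)
module Eval₂ (a : 𝔽₄) =
  Substitution 𝔽₄[x] 𝔽₄-commutativeSemiring (evalList a) refl (Eval.substitute-add a)

evalList-mul : ∀ a p q → evalList a (Coefficients.mul 𝔽₄-rawSemiring p q) ≡ evalList a p * evalList a q
evalList-mul a = Eval.substitute-mul a (λ _ _ → refl)

evalList-[] : ∀ a b → evalList a List.[ b ] ≡ b
evalList-[] = from-yes (∀? λ a → ∀? λ b → evalList a List.[ b ] ≟ b)

x⁴≡x : ∀ x → x * (x * (x * x)) ≡ x
x⁴≡x = from-yes (∀? λ x → x * (x * (x * x)) ≟ x)

eval-map : ∀ {A : Set} (φ : A → 𝔽₄) s (v : Vec A 4) →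
  eval (Vec.map φ v) s ≡ substitute 𝔽₄-rawSemiring φ s (Vec.toList v)
eval-map φ s v = trans (cong (evalList s) (toList-map φ v)) (substitute-map id φ s (Vec.toList v))

eval₂-toList₂ : ∀ f a b → eval₂ f a b ≡ evalList₂ a b (toList₂ f)
eval₂-toList₂ f a b = begin
  eval₂ f a b
    ≡⟨ eval-map (λ p → eval p a) b f ⟩
  substitute 𝔽₄-rawSemiring (λ p → eval p a) b (Vec.toList f)
    ≡⟨ substitute-map (evalList a) Vec.toList b (Vec.toList f) ⟨
  evalList₂ a b (List.map Vec.toList (Vec.toList f))
    ≡⟨ cong (evalList₂ a b) (toList-map Vec.toList f) ⟨
  evalList₂ a b (toList₂ f) ∎
  where open ≡-Reasoning

-- Every element of `𝔽₄` satisfies x⁴ = x, so neither reduction changes values: the one in x is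
-- removed coefficient by coefficient, then the one in y.
eval₂-reduce₂ : ∀ L a b → eval₂ (reduce₂ L) a b ≡ evalList₂ a b L
eval₂-reduce₂ L a b = begin
  eval₂ (reduce₂ L) a b
    ≡⟨ eval-map (λ p → eval p a) b (reduce₂ L) ⟩
  substitute 𝔽₄-rawSemiring (λ p → eval p a) b (Vec.toList (Vec.map reduce L′))
    ≡⟨ cong (substitute 𝔽₄-rawSemiring (λ p → eval p a) b) (toList-map reduce L′) ⟩
  substitute 𝔽₄-rawSemiring (λ p → eval p a) b (List.map reduce (Vec.toList L′))
    ≡⟨ substitute-map (λ p → eval p a) reduce b (Vec.toList L′) ⟩
  substitute 𝔽₄-rawSemiring (λ p → eval (reduce p) a) b (Vec.toList L′)
    ≡⟨ substitute-cong (Eval.substitute-reduce a (x⁴≡x a)) b (Vec.toList L′) ⟩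
  evalList₂ a b (Vec.toList L′)
    ≡⟨ Eval₂.substitute-reduce a b (x⁴≡x b) L ⟩
  evalList₂ a b L ∎
  where
  open ≡-Reasoning
  L′ : Vec (List 𝔽₄) 4
  L′ = Coefficients.reduce 𝔽₄[x] L

eval₂-[,] : ∀ f g h a b → eval₂ (f [ g , h ]) a b ≡ eval₂ f (eval g a) (eval h b)
eval₂-[,] f g h a b = begin
  eval₂ (f [ g , h ]) a b
    ≡⟨ eval₂-reduce₂ (substitute 𝔽₄[x,y] (λ p → List.[ p∘g p ]) h[y] (toList₂ f)) a b ⟩
  evalList₂ a b (substitute 𝔽₄[x,y] (λ p → List.[ p∘g p ]) h[y] (toList₂ f))
    ≡⟨ substitute-homo 𝔽₄[x,y] (evalList₂ a b) refl
         (Eval₂.substitute-add a b) (Eval₂.substitute-mul a b (evalList-mul a))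
         (λ p → List.[ p∘g p ]) h[y] (toList₂ f) ⟩
  substitute 𝔽₄-rawSemiring (λ p → evalList₂ a b List.[ p∘g p ]) (evalList₂ a b h[y]) (toList₂ f)
    ≡⟨ substitute-cong eval-p∘g (evalList₂ a b h[y]) (toList₂ f) ⟩
  evalList₂ (eval g a) (evalList₂ a b h[y]) (toList₂ f)
    ≡⟨ cong (λ t → evalList₂ (eval g a) t (toList₂ f)) eval-h[y] ⟩
  evalList₂ (eval g a) (eval h b) (toList₂ f)
    ≡⟨ eval₂-toList₂ f (eval g a) (eval h b) ⟨
  eval₂ f (eval g a) (eval h b) ∎
  where
  open ≡-Reasoning
  -- Copies of the local definitions of `_[_,_]`, equal to them by computation.
  p∘g : List 𝔽₄ → List 𝔽₄
  p∘g = substitute 𝔽₄[x] List.[_] (Vec.toList g)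

  h[y] : List (List 𝔽₄)
  h[y] = List.map List.[_] (Vec.toList h)

  eval-p∘g : ∀ p → evalList₂ a b List.[ p∘g p ] ≡ evalList (eval g a) p
  eval-p∘g p = begin
    evalList a (p∘g p) + b * 𝟎  ≡⟨ cong (evalList a (p∘g p) +_) (zeroʳ b) ⟩
    evalList a (p∘g p) + 𝟎      ≡⟨ +-identityʳ _ ⟩
    evalList a (p∘g p)          ≡⟨ substitute-homo 𝔽₄[x] (evalList a) refl
                                     (Eval.substitute-add a) (evalList-mul a) List.[_] (Vec.toList g) p ⟩
    substitute 𝔽₄-rawSemiring (evalList a ∘ List.[_]) (eval g a) p
                                ≡⟨ substitute-cong (evalList-[] a) (eval g a) p ⟩
    evalList (eval g a) p       ∎

  eval-h[y] : evalList₂ a b h[y] ≡ eval h b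
  eval-h[y] = trans (substitute-map (evalList a) List.[_] b (Vec.toList h))
                    (substitute-cong (evalList-[] a) b (Vec.toList h))

-- Both sides are the same double sum over the coefficients, taken in the two possible orders; the
-- induction in `go` adds one row at a time.
eval-⟨x,⟩ : ∀ f a b → eval (f ⟨x, b ⟩) a ≡ eval₂ f a b
eval-⟨x,⟩ f a b = begin
  eval (f ⟨x, b ⟩) a
    ≡⟨ go f ⟩
  substitute 𝔽₄-rawSemiring (λ p → eval p a) b (Vec.toList f)
    ≡⟨ eval-map (λ p → eval p a) b f ⟨
  eval₂ f a b ∎
  where
  open ≡-Reasoning
  evalVec : ∀ {n} → 𝔽₄ → Vec 𝔽₄ n → 𝔽₄
  evalVec s v = evalList s (Vec.toList v)

  interchange : ∀ x q r t → (x + b * q) + a * (r + b * t) ≡ (x + a * r) + b * (q + a * t)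
  interchange = solve 6 (λ a b x q r t →
    (x :+ b :* q) :+ a :* (r :+ b :* t) := (x :+ a :* r) :+ b :* (q :+ a :* t)) refl a b
    where open SemiringSolver 𝔽₄-commutativeSemiring using (solve; _:+_; _:*_; _:=_)

  -- The argument of `Vec.map` is what `Vec.transpose` computes to on a nonempty matrix with first
  -- row `r`, where `t` is the transpose of the other rows.
  evalVec-∷ : ∀ {m n} (r : Vec 𝔽₄ n) (t : Vec (Vec 𝔽₄ m) n) →
    evalVec a (Vec.map (evalVec b) (Vec.replicate n _∷_ Vec.⊛ r Vec.⊛ t))
    ≡ evalVec a r + b * evalVec a (Vec.map (evalVec b) t)
  evalVec-∷ []      []      = sym (zeroʳ b)
  evalVec-∷ (x ∷ r) (q ∷ t) = trans
    (cong (λ u → (x + b * evalVec b q) + a * u) (evalVec-∷ r t))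
    (interchange x (evalVec b q) (evalVec a r) (evalVec a (Vec.map (evalVec b) t)))

  evalVec-replicate : ∀ n → evalVec a (Vec.map (evalVec b) (Vec.replicate n [])) ≡ 𝟎
  evalVec-replicate zero    = refl
  evalVec-replicate (suc n) = trans (cong (a *_) (evalVec-replicate n)) (zeroʳ a)

  go : ∀ {m n} (ps : Vec (Vec 𝔽₄ n) m) →
    evalVec a (Vec.map (evalVec b) (Vec.transpose ps))
    ≡ substitute 𝔽₄-rawSemiring (evalVec a) b (Vec.toList ps)
  go {n = n} [] = evalVec-replicate n
  go (p ∷ ps)   = trans (evalVec-∷ p (Vec.transpose ps)) (cong (λ u → evalVec a p + b * u) (go ps))

-- Polynomial functions determine their polynomials

-- The coefficients of the sum of f(e)(1 - (x - e)³) over e ∈ 𝔽₄.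
interpolate : 𝔽₄ → 𝔽₄ → 𝔽₄ → 𝔽₄ → Poly
interpolate f₀ f₁ f₂ f₃ =
  f₀ ∷ f₁ + ω² * f₂ + ω * f₃ ∷ f₁ + ω * f₂ + ω² * f₃ ∷ f₀ + f₁ + f₂ + f₃ ∷ []

interpolate-eval : ∀ p → interpolate (eval p 𝟎) (eval p 𝟏) (eval p ω) (eval p ω²) ≡ p
interpolate-eval (c₀ ∷ c₁ ∷ c₂ ∷ c₃ ∷ []) = from-yes
  (∀? λ c₀ → ∀? λ c₁ → ∀? λ c₂ → ∀? λ c₃ →
    let p = c₀ ∷ c₁ ∷ c₂ ∷ c₃ ∷ [] in
    ≡-dec _≟_ (interpolate (eval p 𝟎) (eval p 𝟏) (eval p ω) (eval p ω²)) p) c₀ c₁ c₂ c₃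

eval-injective : ∀ p q → (∀ x → eval p x ≡ eval q x) → p ≡ q
eval-injective p q p≗q = begin
  p
    ≡⟨ interpolate-eval p ⟨
  interpolate (eval p 𝟎) (eval p 𝟏) (eval p ω) (eval p ω²)
    ≡⟨ cong₂ (λ f g → f g) (cong₂ (λ f g → f g) (cong₂ interpolate (p≗q 𝟎) (p≗q 𝟏)) (p≗q ω)) (p≗q ω²) ⟩
  interpolate (eval q 𝟎) (eval q 𝟏) (eval q ω) (eval q ω²)
    ≡⟨ interpolate-eval q ⟩
  q ∎
  where open ≡-Reasoning

-- Uniqueness in one variable is used twice: for fixed x it gives equal coefficients of the powers
-- of y, and these, as x varies, are values of polynomials in x.
eval₂-injective : ∀ f g → (∀ x y → eval₂ f x y ≡ eval₂ g x y) → f ≡ g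
eval₂-injective f g f≗g =
  go f g λ x → eval-injective (f ⟨ x ,y⟩) (g ⟨ x ,y⟩) (f≗g x)
  where
  go : ∀ {n} (ps qs : Vec Poly n) →
    (∀ x → Vec.map (λ p → eval p x) ps ≡ Vec.map (λ p → eval p x) qs) → ps ≡ qs
  go []       []       _  = refl
  go (p ∷ ps) (q ∷ qs) eq = cong₂ _∷_
    (eval-injective p q λ x → proj₁ (∷-injective (eq x)))
    (go ps qs λ x → proj₂ (∷-injective (eq x)))

-- Permutations

∃? : {P : 𝔽₄ → Set} → (∀ x → Dec (P x)) → Dec (∃[ x ] P x)
∃? P? = map′
  (λ { (inj₁ p) → 𝟎 , p ; (inj₂ (inj₁ p)) → 𝟏 , p
     ; (inj₂ (inj₂ (inj₁ p))) → ω , p ; (inj₂ (inj₂ (inj₂ p))) → ω² , p })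
  (λ { (𝟎 , p) → inj₁ p ; (𝟏 , p) → inj₂ (inj₁ p)
     ; (ω , p) → inj₂ (inj₂ (inj₁ p)) ; (ω² , p) → inj₂ (inj₂ (inj₂ p)) })
  (P? 𝟎 ⊎-dec P? 𝟏 ⊎-dec P? ω ⊎-dec P? ω²)

-- The arguments are explicit, unlike those in `Bijective`, to fit `∀?`.
Injective : (𝔽₄ → 𝔽₄) → Set
Injective f = ∀ x y → f x ≡ f y → x ≡ y

injective? : ∀ f → Dec (Injective f)
injective? f = ∀? λ x → ∀? λ y → (f x ≟ f y) →-dec (x ≟ y)

leftInverse⇒injective : ∀ (f g : 𝔽₄ → 𝔽₄) → (∀ x → f (g x) ≡ x) → Injective g
leftInverse⇒injective f g fg x y gx≡gy = trans (sym (fg x)) (trans (cong f gx≡gy) (fg y))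

𝒫₄? : ∀ p → Dec (𝒫₄ p)
𝒫₄? p = map′
  (λ (inj , surj) → (λ {x} {y} → inj x y)
                  , λ y → proj₁ (surj y) , λ { refl → proj₂ (surj y) })
  (λ (inj , surj) → (λ x y → inj {x} {y}) , λ y → proj₁ (surj y) , proj₂ (surj y) refl)
  (injective? (eval p) ×-dec ∀? λ y → ∃? λ x → eval p x ≟ y)

reducedPoly-ℛℒ𝒫₄ : ∀ a → ℛℒ𝒫₄ (reducedPoly a)
reducedPoly-ℛℒ𝒫₄ = from-yes (∀? λ a →
  (∀? λ b → 𝒫₄? (reducedPoly a ⟨x, b ⟩) ×-dec 𝒫₄? (reducedPoly a ⟨ b ,y⟩))
  ×-dec ≡-dec _≟_ (reducedPoly a ⟨x, 𝟎 ⟩) identity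
  ×-dec ≡-dec _≟_ (reducedPoly a ⟨ 𝟎 ,y⟩) identity)

-- The x³ coefficient is the sum of all values (see `interpolate`), which is 0 for a permutation.
-- Nonzero cubes are 1, so b³ + c³ = 1 says that exactly one of b, c is nonzero; otherwise bx² + cx
-- vanishes identically or has the nonzero root c/b. The proof checks all 256 coefficient vectors.
permutation⇒quadratic : ∀ p → 𝒫₄ p →
  ∃[ b ] ∃[ c ] ∃[ d ] (b ^ 3 + c ^ 3 ≡ 𝟏 × p ≡ quadratic b c d)
permutation⇒quadratic (d ∷ c ∷ b ∷ e ∷ []) (inj , _) =
  let b³+c³≡𝟏 , e≡𝟎 = from-yes
        (∀? λ b → ∀? λ c → ∀? λ d → ∀? λ e →
          injective? (eval (d ∷ c ∷ b ∷ e ∷ [])) →-dec ((b ^ 3 + c ^ 3 ≟ 𝟏) ×-dec (e ≟ 𝟎)))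
        b c d e (λ x y → inj {x} {y})
  in b , c , d , b³+c³≡𝟏 , cong (λ e → d ∷ c ∷ b ∷ e ∷ []) e≡𝟎

-- Reduced Latin squares

-- Functions given by four values can be enumerated with `∀?`. The type `A` is general so that a
-- square can be a table of rows.
table : {A : Set} → A → A → A → A → 𝔽₄ → A
table w x y z 𝟎  = w
table w x y z 𝟏  = x
table w x y z ω  = y
table w x y z ω² = z

tabulate : (𝔽₄ → 𝔽₄) → 𝔽₄ → 𝔽₄
tabulate f = table (f 𝟎) (f 𝟏) (f ω) (f ω²)

tabulate-≗ : ∀ f x → tabulate f x ≡ f x
tabulate-≗ f 𝟎  = refl
tabulate-≗ f 𝟏  = refl
tabulate-≗ f ω  = refl
tabulate-≗ f ω² = refl

Injective-resp-≗ : ∀ {f g} → (∀ x → f x ≡ g x) → Injective g → Injective f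
Injective-resp-≗ f≗g inj x y fx≡fy = inj x y (trans (sym (f≗g x)) (trans fx≡fy (f≗g y)))

-- The first entry is fixed by an equation because the rows of a given square satisfy it only
-- propositionally. Later rows are tried only after the premises on earlier ones hold, which leaves
-- 6 candidates per row.
∀Row : 𝔽₄ → ((𝔽₄ → 𝔽₄) → Set) → Set
∀Row u P = ∀ w x y z → w ≡ u → Injective (table w x y z) → P (table w x y z)

∀Row? : ∀ u {P} → (∀ r → Dec (P r)) → Dec (∀Row u P)
∀Row? u P? = ∀? λ w → ∀? λ x → ∀? λ y → ∀? λ z →
  (w ≟ u) →-dec (injective? (table w x y z) →-dec P? (table w x y z))

-- A search through 6³ = 216 squares with row 0 equal to `id`. The survivors are group tables: a = 0
-- gives the addition of `𝔽₄`, and a nonzero a gives the cyclic group whose element of order two is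
-- a, since the diagonal is x + a²x².
reducedLatinTables : ∀Row 𝟏 λ r₁ → ∀Row ω λ r₂ → ∀Row ω² λ r₃ →
  let sq = table id r₁ r₂ r₃ in
  (∀ y → Injective (λ x → sq x y)) → ∃[ a ] (∀ x y → sq x y ≡ eval₂ (reducedPoly a) x y)
reducedLatinTables = from-yes
  (∀Row? 𝟏 λ r₁ → ∀Row? ω λ r₂ → ∀Row? ω² λ r₃ →
    let sq = table id r₁ r₂ r₃ in
    (∀? λ y → injective? (λ x → sq x y))
    →-dec (∃? λ a → ∀? λ x → ∀? λ y → sq x y ≟ eval₂ (reducedPoly a) x y))

reducedLatin⇒reducedPoly : (G : 𝔽₄ → 𝔽₄ → 𝔽₄) →
  (∀ x → G x 𝟎 ≡ x) → (∀ y → G 𝟎 y ≡ y) →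
  (∀ x → Injective (G x)) → (∀ y → Injective (λ x → G x y)) →
  ∃[ a ] (∀ x y → G x y ≡ eval₂ (reducedPoly a) x y)
reducedLatin⇒reducedPoly G col₀ row₀ rowInj colInj =
  -- The entries left as underscores are found by unification with the types of `col₀` and `tabInj`.
  let a , sq≗ = reducedLatinTables
        _ _ _ _ (col₀ 𝟏)  (tabInj 𝟏)
        _ _ _ _ (col₀ ω)  (tabInj ω)
        _ _ _ _ (col₀ ω²) (tabInj ω²)
        (λ y → Injective-resp-≗ (λ x → sq≗G x y) (colInj y))
  in a , λ x y → trans (sym (sq≗G x y)) (sq≗ x y)
  where
  tabInj : ∀ x → Injective (tabulate (G x))
  tabInj x = Injective-resp-≗ (tabulate-≗ (G x)) (rowInj x)

  sq≗G : ∀ x y → table id (tabulate (G 𝟏)) (tabulate (G ω)) (tabulate (G ω²)) x y ≡ G x y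
  sq≗G 𝟎  y = sym (row₀ y)
  sq≗G 𝟏  y = tabulate-≗ (G 𝟏) y
  sq≗G ω  y = tabulate-≗ (G ω) y
  sq≗G ω² y = tabulate-≗ (G ω²) y

-- Normalising a Latin square

module _ (p : Poly₂) (latin : ℒ𝒫₄ p) where
  private
    F : 𝔽₄ → 𝔽₄ → 𝔽₄
    F = eval₂ p

    rowInj : ∀ x → Injective (F x)
    rowInj x y y′ = proj₁ (proj₂ (latin x))

    colInj : ∀ y → Injective (λ x → F x y)
    colInj y = Injective-resp-≗ (λ x → sym (eval-⟨x,⟩ p x y)) (λ x x′ → proj₁ (proj₁ (latin y)))

    h′ : Poly
    h′ = p ⟨ 𝟎 ,y⟩

    h′⁻¹ : 𝔽₄ → 𝔽₄
    h′⁻¹ v = proj₁ (proj₂ (proj₂ (latin 𝟎)) v)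

    h′-h′⁻¹ : ∀ v → eval h′ (h′⁻¹ v) ≡ v
    h′-h′⁻¹ v = proj₂ (proj₂ (proj₂ (latin 𝟎)) v) refl

    y₀ : 𝔽₄
    y₀ = h′⁻¹ 𝟎

    h : Poly
    h = p ⟨x, y₀ ⟩

    h⁻¹ : 𝔽₄ → 𝔽₄
    h⁻¹ u = proj₁ (proj₂ (proj₁ (latin y₀)) u)

    h-h⁻¹ : ∀ u → F (h⁻¹ u) y₀ ≡ u
    h-h⁻¹ u = trans (sym (eval-⟨x,⟩ p (h⁻¹ u) y₀)) (proj₂ (proj₂ (proj₁ (latin y₀)) u) refl)

    -- Surjectivity supplies a right inverse; injectivity of column `y₀` makes it two-sided.
    h⁻¹-h : ∀ x → h⁻¹ (eval h x) ≡ x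
    h⁻¹-h x = colInj y₀ _ _ (trans (h-h⁻¹ (eval h x)) (eval-⟨x,⟩ p x y₀))

    h′⁻¹-h′ : ∀ y → h′⁻¹ (eval h′ y) ≡ y
    h′⁻¹-h′ y = rowInj 𝟎 _ _ (h′-h′⁻¹ (eval h′ y))

    -- Column `y₀` has the entry 0 in both rows, by the choice of `h⁻¹` and of `y₀`. This is why `h`
    -- is read off in that column: row 0 of the normalised square is then row 0 of `F` composed with
    -- `h′⁻¹`, the identity.
    h⁻¹-𝟎 : h⁻¹ 𝟎 ≡ 𝟎
    h⁻¹-𝟎 = colInj y₀ _ _ (trans (h-h⁻¹ 𝟎) (sym (h′-h′⁻¹ 𝟎)))

  latin⇒composition : ∃[ g ] ∃[ h ] (𝒫₄ g × 𝒫₄ h × ∃[ a ] p ≡ reducedPoly a [ g , h ])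
  latin⇒composition =
    let a , G≗ = reducedLatin⇒reducedPoly (λ u v → F (h⁻¹ u) (h′⁻¹ v))
          -- Column 0 is the identity because `h′⁻¹ 𝟎` is `y₀` by definition.
          h-h⁻¹
          (λ v → trans (cong (λ x → F x (h′⁻¹ v)) h⁻¹-𝟎) (h′-h′⁻¹ v))
          -- Each row is a row of `F` after `h′⁻¹`, which is injective with left inverse `F 𝟎`;
          -- columns are treated alike.
          (λ u v v′ → leftInverse⇒injective (F 𝟎) h′⁻¹ h′-h′⁻¹ v v′ ∘ rowInj (h⁻¹ u) _ _)
          (λ v u u′ → leftInverse⇒injective (λ x → F x y₀) h⁻¹ h-h⁻¹ u u′ ∘ colInj (h′⁻¹ v) _ _)
    in h , h′ , proj₁ (latin y₀) , proj₂ (latin 𝟎) , a , eval₂-injective _ _ λ x y → begin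
      F x y                                         ≡⟨ cong₂ F (h⁻¹-h x) (h′⁻¹-h′ y) ⟨
      F (h⁻¹ (eval h x)) (h′⁻¹ (eval h′ y))         ≡⟨ G≗ (eval h x) (eval h′ y) ⟩
      eval₂ (reducedPoly a) (eval h x) (eval h′ y)  ≡⟨ eval₂-[,] (reducedPoly a) h h′ x y ⟨
      eval₂ (reducedPoly a [ h , h′ ]) x y          ∎
    where open ≡-Reasoning

theorem4p1 : ∀ (p : Poly₂) → ℒ𝒫₄ p →
    ∃[ a ] ∃[ b ] ∃[ c ] ∃[ d ] ∃[ b′ ] ∃[ c′ ] ∃[ d′ ]
    ( b ^ 3 + c ^ 3 ≡ 𝟏
    × b′ ^ 3 + c′ ^ 3 ≡ 𝟏
    × ℛℒ𝒫₄ (reducedPoly a)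
    × 𝒫₄ (quadratic b c d)
    × 𝒫₄ (quadratic b′ c′ d′)
    × p ≡ reducedPoly a [ quadratic b c d , quadratic b′ c′ d′ ] )
theorem4p1 p latin =
  let g , h , g-perm , h-perm , a , p≡ = latin⇒composition p latin
      b  , c  , d  , b³+c³≡𝟏   , g≡ = permutation⇒quadratic g g-perm
      b′ , c′ , d′ , b′³+c′³≡𝟏 , h≡ = permutation⇒quadratic h h-perm
  in a , b , c , d , b′ , c′ , d′
   , b³+c³≡𝟏 , b′³+c′³≡𝟏 , reducedPoly-ℛℒ𝒫₄ a
   , subst 𝒫₄ g≡ g-perm , subst 𝒫₄ h≡ h-perm
   , trans p≡ (cong₂ (reducedPoly a [_,_]) g≡ h≡)
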